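{- For integers $n\ge 1$ and $k\ge 1$, let $\hat G(k,n)$ denote any graph obtained from the $n\times n$ planar grid by adding a set $X$ of $k$ new vertices, joining every vertex of $X$ to all $n^2$ vertices of the grid, and then possibly adding some edges (an arbitrary set, possibly empty) among the vertices of $X$. Then the following hold. (i) If $\hat G(k,n)=\bigcap_{i=1}^{d}G_i$ with $d\ge 2$ and $G_1$ chordal, then $$\max_{2\le i\le d} ccw(G_i)=\Omega\left(n^{\frac{1}{d-1}}\right).$$ That is, there are absolute constants $c>0$ and $n_0$ such that for all $n\ge n_0$, $k\ge 1$, $d\ge 2$, every such graph $\hat G(k,n)$, and all graphs $G_1,\dots,G_d$ with $G_1$ chordal and $\hat G(k,n)=\bigcap_{i=1}^{d}G_i$, one has $\max_{2\le i\le d} ccw(G_i)\ge c\, n^{1/(d-1)}$. (ii) For every such graph $\hat G(k,n)$ there are a chordal graph $G_1$ and a graph $G_2$ with $ccw(G_2)\le \frac{n}{2}+k$ such that $\hat G(k,n)=G_1\cap G_2$.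
   Context: All graphs are finite, simple and undirected. A chordal graph is a graph with no chordless cycle (no induced cycle of length at least $4$). The $n\times n$ grid is the graph with vertex set $\{1,\dots,n\}^2$ in which $(a,b)$ and $(a',b')$ are adjacent if and only if $|a-a'|+|b-b'|=1$. Edge intersection: if $G_1,\dots,G_d$ are graphs on the same vertex set $V$, then $G=\bigcap_{i=1}^d G_i$ means that $G$ is the graph with $V(G)=V$ and $E(G)=\bigcap_{i=1}^d E(G_i)$. In particular every $G_i$ has the same vertex set as $G$. For $d=2$ this is written $G=G_1\cap G_2$. Clique cover width: a clique cover of $G$ is a partition of $V(G)$ into cliques. It is taken as an ordered list $C=\{C_0,C_1,\dots,C_t\}$. The width of $C$ is $w(C)=\max\{|j-i| : xy\in E(G),\ x\in C_i,\ y\in C_j\}$ (and $0$ if $G$ has no edges). The clique cover width $ccw(G)$ is the minimum of $w(C)$ over all ordered clique covers $C$ of $G$. -}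

module Defs where

open import Data.Bool.Base using (if_then_else_)
open import Data.Fin.Base using (Fin; zero; suc; toℕ; finToFun; funToFin)
import Data.Fin.Properties as Fin
open import Data.Nat.Base using (ℕ; zero; suc; _+_; _*_; _^_; _≤_; _<_; _⊔_; ∣_-_∣; s≤s)
open import Data.Nat.Induction using (<-rec)
import Data.Nat.Properties as ℕ
open import Data.Product.Base using (Σ; ∃; _×_; _,_; proj₁; proj₂)
open import Data.Sum.Base using (_⊎_; inj₁; inj₂)
open import Data.Vec.Functional using (Vector; foldr)
open import Function.Base using (id; _∘_)
open import Function.Bundles using (_↔_; _⇔_; Inverse)
open import Function.Definitions using (Injective; StrictlySurjective)
open import Level using (0ℓ)
open import Relation.Binary.Core using (Rel)
open import Relation.Binary.Definitions using (Symmetric; Irreflexive)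
import Relation.Binary.Definitions as B
open import Relation.Binary.PropositionalEquality
  using (_≡_; _≢_; _≗_; refl; sym; trans; cong; cong₂)
open import Relation.Nullary.Decidable
  using (Dec; yes; no; does; map′; ¬?; _×-dec_; _→-dec_)
open import Relation.Nullary.Negation using (¬_; contradiction)
open import Relation.Unary using (Pred; Decidable)

record Graph (m : ℕ) : Set₁ where
  field
    Adj     : Rel (Fin m) 0ℓ
    adj?    : B.Decidable Adj
    symm    : Symmetric Adj
    irrefl  : Irreflexive _≡_ Adj

open Graph public

_IsIntersectionOf_ : ∀ {m} {I : Set} → Graph m → (I → Graph m) → Set
G IsIntersectionOf Gs = ∀ u v → Adj G u v ⇔ (∀ i → Adj (Gs i) u v)

Next : ∀ {ℓ} → Rel (Fin ℓ) 0ℓ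
Next {ℓ} i j = suc (toℕ i) ≡ toℕ j ⊎ (suc (toℕ i) ≡ ℓ × toℕ j ≡ 0)

-- Stated with "⇔", adjacency gives both the edges of the cycle and the absence
-- of chords.
IsChordlessCycle : ∀ {m ℓ} → Graph m → (Fin ℓ → Fin m) → Set
IsChordlessCycle G c =
  Injective _≡_ _≡_ c × (∀ i j → Adj G (c i) (c j) ⇔ (Next i j ⊎ Next j i))

Chordal : ∀ {m} → Graph m → Set
Chordal {m} G = ∀ ℓ → 4 ≤ ℓ → (c : Fin ℓ → Fin m) → ¬ IsChordlessCycle G c

-- The value 0 for the empty vector is harmless: every maximum below is over a
-- nonempty index set, or is a width, which is 0 when there are no edges.
max : ∀ {n} → Vector ℕ n → ℕ
max = foldr _⊔_ 0

-- An ordered list of t classes partitioning the vertices is encoded by the map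
-- sending each vertex to the position of its class; strict surjectivity says
-- that no class is empty.
IsCliqueCover : ∀ {m t} → Graph m → (Fin m → Fin t) → Set
IsCliqueCover G C =
  StrictlySurjective _≡_ C × (∀ x y → x ≢ y → C x ≡ C y → Adj G x y)

width : ∀ {m t} → Graph m → (Fin m → Fin t) → ℕ
width G C = max λ x → max λ y →
  if does (adj? G x y) then ∣ toℕ (C y) - toℕ (C x) ∣ else 0

HasCoverOfWidth : ∀ {m} → Graph m → ℕ → Set
HasCoverOfWidth {m} G w =
  ∃ λ t → Σ (Fin m → Fin t) λ C → IsCliqueCover G C × width G C ≡ w

IsMinimum : Pred ℕ 0ℓ → ℕ → Set
IsMinimum P w = P w × (∀ v → P v → w ≤ v)

max-cong : ∀ {n} {f g : Vector ℕ n} → f ≗ g → max f ≡ max g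
max-cong {zero}  f≗g = refl
max-cong {suc n} f≗g = cong₂ _⊔_ (f≗g zero) (max-cong (f≗g ∘ suc))

width-cong : ∀ {m t} (G : Graph m) {C D : Fin m → Fin t} → C ≗ D → width G C ≡ width G D
width-cong G C≗D = max-cong λ x → max-cong λ y →
  cong₂ (λ c d → if does (adj? G x y) then ∣ toℕ c - toℕ d ∣ else 0) (C≗D y) (C≗D x)

isCliqueCover-cong : ∀ {m t} (G : Graph m) {C D : Fin m → Fin t} →
                     C ≗ D → IsCliqueCover G C → IsCliqueCover G D
isCliqueCover-cong G C≗D (surj , clique) =
  (λ c → proj₁ (surj c) , trans (sym (C≗D _)) (proj₂ (surj c))) ,
  (λ x y x≢y Dx≡Dy → clique x y x≢y (trans (C≗D x) (trans Dx≡Dy (sym (C≗D y)))))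

isCliqueCover? : ∀ {m t} (G : Graph m) (C : Fin m → Fin t) → Dec (IsCliqueCover G C)
isCliqueCover? G C =
  Fin.all? (λ c → Fin.any? (λ x → C x Fin.≟ c))
  ×-dec
  Fin.all? (λ x → Fin.all? (λ y →
    ¬? (x Fin.≟ y) →-dec ((C x Fin.≟ C y) →-dec adj? G x y)))

surjective⇒≤ : ∀ {m t} {C : Fin m → Fin t} → StrictlySurjective _≡_ C → t ≤ m
surjective⇒≤ {C = C} surj = Fin.injective⇒≤ {f = proj₁ ∘ surj} λ {c} {d} eq →
  trans (sym (proj₂ (surj c))) (trans (cong C eq) (proj₂ (surj d)))

hasCoverOfWidth? : ∀ {m} (G : Graph m) → Decidable (HasCoverOfWidth G)
hasCoverOfWidth? {m} G w = map′ to from (ℕ.anyUpTo? codes? (suc m))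
  where
  Codes : ℕ → Set
  Codes t = ∃ λ (i : Fin (t ^ m)) →
    IsCliqueCover G (finToFun {t} {m} i) × width G (finToFun {t} {m} i) ≡ w

  codes? : Decidable Codes
  codes? t = Fin.any? λ i →
    isCliqueCover? G (finToFun {t} {m} i) ×-dec (width G (finToFun {t} {m} i) ℕ.≟ w)

  to : (∃ λ t → t < suc m × Codes t) → HasCoverOfWidth G w
  to (t , _ , i , cover , eq) = t , finToFun i , cover , eq

  from : HasCoverOfWidth G w → ∃ λ t → t < suc m × Codes t
  from (t , C , cover , eq) =
    t , s≤s (surjective⇒≤ (proj₁ cover)) , funToFin C ,
    isCliqueCover-cong G (sym ∘ Fin.finToFun-funToFin C) cover ,
    trans (width-cong G (Fin.finToFun-funToFin C)) eq

singletonCover : ∀ {m} (G : Graph m) → HasCoverOfWidth G (width G id)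
singletonCover {m} G =
  m , id , ((λ x → x , refl) , (λ x y x≢y x≡y → contradiction x≡y x≢y)) , refl

minimum : ∀ {P : Pred ℕ 0ℓ} → Decidable P → ∃ P → ∃ (IsMinimum P)
minimum {P} P? (n₀ , p₀) = <-rec (λ n → P n → ∃ (IsMinimum P)) step n₀ p₀
  where
  step : ∀ n → (∀ {v} → v < n → P v → ∃ (IsMinimum P)) → P n → ∃ (IsMinimum P)
  step n rec p with ℕ.anyUpTo? P? n
  ... | yes (v , v<n , q) = rec v<n q
  ... | no  none          = n , p , λ v q → ℕ.≮⇒≥ λ v<n → none (v , v<n , q)

-- Abstract because the search should never be unfolded: the type already
-- determines the number.
abstract
  leastWidth : ∀ {m} (G : Graph m) → ∃ (IsMinimum (HasCoverOfWidth G))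
  leastWidth G = minimum (hasCoverOfWidth? G) (width G id , singletonCover G)

ccw : ∀ {m} → Graph m → ℕ
ccw G = proj₁ (leastWidth G)

ccw-isMinimum : ∀ {m} (G : Graph m) → IsMinimum (HasCoverOfWidth G) (ccw G)
ccw-isMinimum G = proj₂ (leastWidth G)

-- Coordinates run from 0 to n - 1, which changes no differences.
GridAdj : ∀ {n} → Rel (Fin n × Fin n) 0ℓ
GridAdj (a , b) (a′ , b′) = ∣ toℕ a - toℕ a′ ∣ + ∣ toℕ b - toℕ b′ ∣ ≡ 1

-- G is one of the graphs Ĝ(k,n), with its vertices identified with those of the
-- grid together with k new ones.  Adjacency among the new vertices is left
-- unconstrained.
record Ĝ (k n : ℕ) {m : ℕ} (G : Graph m) : Set where
  field
    vertices : Fin m ↔ ((Fin n × Fin n) ⊎ Fin k)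

  grid : Fin n × Fin n → Fin m
  grid = Inverse.from vertices ∘ inj₁

  new : Fin k → Fin m
  new = Inverse.from vertices ∘ inj₂

  field
    grid-edges : ∀ p q → Adj G (grid p) (grid q) ⇔ GridAdj p q
    join-edges : ∀ x p → Adj G (new x) (grid p)

-- For r ≥ 1 and q > 0, raising to the r-th power and clearing denominators turns
-- M ≥ (p / q) · n^(1/r) into this inequality of natural numbers.
_≥[_/_]·root[_]_ : ℕ → ℕ → ℕ → ℕ → ℕ → Set
M ≥[ p / q ]·root[ r ] n = p ^ r * n ≤ (q * M) ^ r

{-# OPTIONS --safe #-}

-- (i) In a chordal graph some clique meets every member of a family of connected,
-- pairwise touching vertex sets: remove simplicial vertices one at a time, until
-- one of the sets is a single simplicial vertex, whose closed neighbourhood will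
-- do.  For the crosses (a row together with a column) of the grid this gives a
-- clique of G₁ that meets all rows or all columns, hence a clique of ⌈n/2⌉ grid
-- vertices that are pairwise at distance at least 2.  They are independent in Ĝ
-- but joined to a new vertex x, so in each of G₂, …, G_d their classes lie within
-- distance M, the largest of the widths, of the class of x, and no two of them
-- share all d - 1 classes: ⌈n/2⌉ ≤ (2M + 1)^(d - 1).
--
-- (ii) In G₁ two vertices are adjacent when their rows differ by at most 1 or one
-- of them is new.  G₂ is Ĝ with every column turned into a clique; its classes are
-- the columns and the single new vertices, the latter placed in the middle.
module Submission where

open import Defs
open import Data.Bool.Base using (if_then_else_)
open import Data.Empty using (⊥)
open import Data.Fin.Base
  using (Fin; zero; suc; toℕ; fromℕ; fromℕ<; inject₁; funToFin; finToFun)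
import Data.Fin.Properties as Fin
open import Data.List.Base using (List; length; lookup; filter; allFin)
import Data.Nat.Properties as ℕ
open import Data.List.Extrema ℕ.≤-totalOrder using (argmin; f[argmin]≤f[xs])
open import Data.List.Membership.Propositional using (_∈_; find; lose)
open import Data.List.Membership.Propositional.Properties
  using (∈-filter⁺; ∈-filter⁻; ∈-lookup; ∈-allFin)
open import Data.List.Properties using (filter-notAll)
open import Data.List.Relation.Unary.All as All using (All)
open import Data.List.Relation.Unary.All.Properties using (¬Any⇒All¬)
open import Data.List.Relation.Unary.Any as Any using (Any; here; there; any?)
open import Data.Nat.Base
  using (ℕ; zero; suc; _+_; _*_; _∸_; _^_; ∣_-_∣; ⌊_/2⌋; ⌈_/2⌉; _≤_; _<_; z≤n; s≤s; s≤s⁻¹)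
open import Data.Nat.Induction using (Acc; acc; <-wellFounded)
open import Data.Product.Base using (Σ; ∃; ∃₂; _×_; _,_; proj₁; proj₂)
open import Data.Sum.Base using (_⊎_; inj₁; inj₂; swap)
open import Data.Sum.Properties using (inj₁-injective)
open import Data.Unit.Base using (⊤; tt)
open import Data.Vec.Functional using (Vector)
open import Function.Base using (_∘_; id)
open import Function.Bundles using (Equivalence; Inverse; mk⇔)
open import Level using (0ℓ)
open import Relation.Binary.Construct.Closure.Reflexive as Refl using (ReflClosure; refl; [_])
import Relation.Binary.Construct.Closure.Reflexive.Properties as Refl
open import Relation.Binary.Construct.Closure.ReflexiveTransitive
  using (Star; ε; _◅_; _◅◅_; gmap)
open import Relation.Binary.Core using (Rel)
import Relation.Binary.Definitions as B
open import Relation.Binary.PropositionalEquality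
  using (_≡_; _≢_; refl; sym; trans; cong; cong₂; subst; subst₂)
open import Relation.Nullary.Decidable
  using (Dec; yes; no; does; dec-true; map′; ¬?; _×-dec_; _⊎-dec_; decidable-stable)
open import Relation.Nullary.Negation using (¬_; contradiction)
open import Relation.Unary using (Pred; Decidable)

-- Induced paths and simplicial vertices in chordal graphs.

module _ {m} (G : Graph m) where
  open import Data.List.Base using ([]; _∷_)
  open import Data.List.Relation.Unary.All using ([]; _∷_)

  Adj⁼ : Rel (Fin m) 0ℓ
  Adj⁼ = ReflClosure (Adj G)

  adj⁼? : B.Decidable Adj⁼
  adj⁼? = Refl.dec Fin._≟_ (adj? G)

  symm⁼ : B.Symmetric Adj⁼
  symm⁼ = Refl.sym (symm G)

  -- Because the last hypothesis excludes `Adj⁼` and not only `Adj`, injectivity comes for free: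
  -- equal vertices at two positions would make the positions consecutive on the cycle, hence the
  -- vertices adjacent, against irreflexivity.
  chordless : ∀ {ℓ} {c : Fin ℓ → Fin m} →
    (∀ i j → suc (toℕ i) ≡ toℕ j → Adj G (c i) (c j)) →
    (∀ i j → suc (toℕ i) ≡ ℓ → toℕ j ≡ 0 → Adj G (c i) (c j)) →
    (∀ i j → suc (toℕ i) < toℕ j → ¬ (suc (toℕ j) ≡ ℓ × toℕ i ≡ 0) → ¬ Adj⁼ (c i) (c j)) →
    IsChordlessCycle G c
  chordless {ℓ} {c} consecutive closing apart = injective , λ i j → mk⇔ (next i j) (adj i j)
    where
    next< : ∀ {i j} → toℕ i < toℕ j → Adj⁼ (c i) (c j) → Next i j ⊎ Next j i
    next< {i} {j} i<j a with suc (toℕ i) ℕ.≟ toℕ j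
    ... | yes eq = inj₁ (inj₁ eq)
    ... | no neq with (suc (toℕ j) ℕ.≟ ℓ) ×-dec (toℕ i ℕ.≟ 0)
    ...   | yes wrap = inj₂ (inj₂ wrap)
    ...   | no ¬wrap = contradiction a (apart i j (ℕ.≤∧≢⇒< i<j neq) ¬wrap)

    adj : ∀ i j → Next i j ⊎ Next j i → Adj G (c i) (c j)
    adj i j (inj₁ (inj₁ eq))          = consecutive i j eq
    adj i j (inj₁ (inj₂ (last , z)))  = closing i j last z
    adj i j (inj₂ (inj₁ eq))          = symm G (consecutive j i eq)
    adj i j (inj₂ (inj₂ (last , z)))  = symm G (closing j i last z)

    next : ∀ i j → Adj G (c i) (c j) → Next i j ⊎ Next j i
    next i j a with ℕ.<-cmp (toℕ i) (toℕ j)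
    ... | B.tri< i<j _ _ = next< i<j [ a ]
    ... | B.tri≈ _ i≡j _ = contradiction a (irrefl G (cong c (Fin.toℕ-injective i≡j)))
    ... | B.tri> _ _ j<i = swap (next< j<i [ symm G a ])

    distinct : ∀ {i j} → toℕ i < toℕ j → c i ≢ c j
    distinct {i} {j} i<j eq = irrefl G eq (adj i j (next< i<j (Refl.reflexive eq)))

    injective : ∀ {i j} → c i ≡ c j → i ≡ j
    injective {i} {j} eq with ℕ.<-cmp (toℕ i) (toℕ j)
    ... | B.tri< i<j _ _ = contradiction eq (distinct i<j)
    ... | B.tri≈ _ i≡j _ = Fin.toℕ-injective i≡j
    ... | B.tri> _ _ j<i = contradiction (sym eq) (distinct j<i)

  -- The vertices of the path are x ∷ xs, and z is its last vertex.
  data InducedPath (z : Fin m) : (x : Fin m) (xs : List (Fin m)) → Set where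
    end  : InducedPath z z []
    cons : ∀ {x y ys} → Adj G x y → All (λ u → ¬ Adj⁼ x u) ys →
           InducedPath z y ys → InducedPath z x (y ∷ ys)

  -- The path is cut at its last vertex equal or adjacent to `x`, so that everything after the cut
  -- is far from `x`.
  extend : ∀ {ℓ} {P : Pred (Fin m) ℓ} {z y ys} x → InducedPath z y ys → All P (y ∷ ys) →
           Any (Adj⁼ x) (y ∷ ys) → ∃ λ xs → InducedPath z x xs × All P xs
  extend {ys = ys} x path ps near with any? (adj⁼? x) ys
  extend x (cons _ _ path) (_ ∷ ps) near        | yes later = extend x path ps later
  extend x path (_ ∷ ps) (here refl)            | no ¬later = _ , path , ps
  extend x path ps (here [ a ])                 | no ¬later = _ , cons a (¬Any⇒All¬ _ ¬later) path , ps
  extend x path ps (there later)                | no ¬later = contradiction later ¬later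

  -- Only the target has to satisfy `P`, so the first vertex of a walk is unconstrained; steps may
  -- also stay in place.
  Step : ∀ {ℓ} → Pred (Fin m) ℓ → Rel (Fin m) ℓ
  Step P x y = P y × Adj⁼ x y

  walk⇒inducedPath : ∀ {ℓ} {P : Pred (Fin m) ℓ} {x z} → Star (Step P) x z →
                     ∃ λ xs → InducedPath z x xs × All P xs
  walk⇒inducedPath ε              = [] , end , []
  walk⇒inducedPath ((p , a) ◅ w) with ys , path , ps ← walk⇒inducedPath w =
    extend _ path (p ∷ ps) (here a)

  path-consecutive : ∀ {z x xs} → InducedPath z x xs → ∀ i j → suc (toℕ i) ≡ toℕ j →
                     Adj G (lookup (x ∷ xs) i) (lookup (x ∷ xs) j)
  path-consecutive (cons a _ _)    zero    (suc zero) _  = a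
  path-consecutive (cons _ _ path) (suc i) (suc j)    eq = path-consecutive path i j (ℕ.suc-injective eq)

  path-apart : ∀ {z x xs} → InducedPath z x xs → ∀ i j → suc (toℕ i) < toℕ j →
               ¬ Adj⁼ (lookup (x ∷ xs) i) (lookup (x ∷ xs) j)
  path-apart (cons _ far _)  zero    (suc (suc j)) _         = All.lookup far (∈-lookup j)
  path-apart (cons _ _ path) (suc i) (suc j)       (s≤s i<j) = path-apart path i j i<j
  path-apart (cons _ _ _)    zero    (suc zero)    (s≤s ())

  lookup-last : ∀ {z x xs} → InducedPath z x xs → ∀ i → toℕ i ≡ length xs → lookup (x ∷ xs) i ≡ z
  lookup-last end             zero    _  = refl
  lookup-last (cons _ _ path) (suc i) eq = lookup-last path i (ℕ.suc-injective eq)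

  last∈ : ∀ {z x xs} → InducedPath z x xs → z ∈ x ∷ xs
  last∈ end             = here refl
  last∈ (cons _ _ path) = there (last∈ path)

  lookup-inner : ∀ {z x xs} → InducedPath z x xs → ∀ i → toℕ i ≢ length xs → lookup (x ∷ xs) i ≢ z
  lookup-inner end               zero    neq eq = neq refl
  lookup-inner (cons a far path) zero    neq refl with last∈ path
  ... | here eq    = irrefl G eq a
  ... | there z∈ys = All.lookup far z∈ys refl
  lookup-inner (cons a far path) (suc i) neq eq = lookup-inner path i (neq ∘ cong suc) eq

  -- An induced path from x to z, closed up through w, would be a chordless cycle.
  bypass : Chordal G → ∀ {w x z} → Adj G w x → Adj G w z →
           Star (Step (λ u → u ≡ z ⊎ ¬ Adj⁼ w u)) x z → Adj⁼ x z
  bypass chordal {w} {x} {z} w~x w~z walk = decidable-stable (adj⁼? x z) λ x≁z →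
    let xs , path , ps = walk⇒inducedPath walk in
    chordal _ (s≤s (s≤s (long x≁z path))) (lookup (w ∷ x ∷ xs))
      (chordless (consecutive path) (closing path) (apart path ps))
    where
    long : ∀ {xs} → ¬ Adj⁼ x z → InducedPath z x xs → 2 ≤ length xs
    long x≁z end                     = contradiction refl x≁z
    long x≁z (cons a _ end)          = contradiction [ a ] x≁z
    long x≁z (cons _ _ (cons _ _ _)) = s≤s (s≤s z≤n)

    consecutive : ∀ {xs} → InducedPath z x xs → ∀ i j → suc (toℕ i) ≡ toℕ j →
                  Adj G (lookup (w ∷ x ∷ xs) i) (lookup (w ∷ x ∷ xs) j)
    consecutive path zero    (suc zero) eq = w~x
    consecutive path (suc i) (suc j)    eq = path-consecutive path i j (ℕ.suc-injective eq)

    closing : ∀ {xs} → InducedPath z x xs → ∀ i j → suc (toℕ i) ≡ 2 + length xs → toℕ j ≡ 0 →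
              Adj G (lookup (w ∷ x ∷ xs) i) (lookup (w ∷ x ∷ xs) j)
    closing path (suc i) zero eq _
      rewrite lookup-last path i (ℕ.suc-injective (ℕ.suc-injective eq)) = symm G w~z

    apart : ∀ {xs} → InducedPath z x xs → All (λ u → u ≡ z ⊎ ¬ Adj⁼ w u) xs →
            ∀ i j → suc (toℕ i) < toℕ j → ¬ (suc (toℕ j) ≡ 2 + length xs × toℕ i ≡ 0) →
            ¬ Adj⁼ (lookup (w ∷ x ∷ xs) i) (lookup (w ∷ x ∷ xs) j)
    apart path ps (suc i) (suc j) (s≤s i<j) _ = path-apart path i j i<j
    apart path ps zero (suc zero) (s≤s ()) _
    apart path ps zero (suc (suc j)) _ ¬wrap with All.lookup ps (∈-lookup j)
    -- The pair set aside by `¬wrap` is `w` with the end `z` of the path; every other path vertex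
    -- differs from `z`, so it must be far from `w`.
    ... | inj₁ eq  = contradiction eq (lookup-inner path (suc j) λ last → ¬wrap (cong (2 +_) last , refl))
    ... | inj₂ far = far

  Connected : Pred (Fin m) 0ℓ → Set
  Connected P = ∀ {x y} → P x → P y → Star (Step P) x y

  -- The region on which simpliciality is claimed. Moving a vertex near `U` into `U` while dropping
  -- its neighbours from `Z` does not shrink it, so the claim passes back through the recursion.
  Near : List (Fin m) → List (Fin m) → Pred (Fin m) 0ℓ
  Near U Z x = x ∈ Z ⊎ Any (Adj⁼ x) U

  SimplicialIn : Pred (Fin m) 0ℓ → Pred (Fin m) 0ℓ
  SimplicialIn P v = ∀ {x y} → P x → P y → Adj G v x → Adj G v y → Adj⁼ x y

  connected-∷ : ∀ {U x} → Connected (_∈ U) → Any (Adj⁼ x) U → Connected (_∈ x ∷ U)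
  connected-∷ {U} {x} connected near = λ where
      (here refl) (here refl) → ε
      (here refl) (there z∈U) → (there u∈U , a) ◅ lift (connected u∈U z∈U)
      (there y∈U) (here refl) → lift (connected y∈U u∈U) ◅◅ (here refl , symm⁼ a) ◅ ε
      (there y∈U) (there z∈U) → lift (connected y∈U z∈U)
    where
    u∈U = proj₁ (proj₂ (find near))
    a   = proj₂ (proj₂ (find near))
    lift : ∀ {y z} → Star (Step (_∈ U)) y z → Star (Step (_∈ x ∷ U)) y z
    lift = gmap id λ (u∈U , a) → there u∈U , a

  -- A neighbour of `v` that is near `U` is adjacent to all of `Z`, by completeness. Two such
  -- neighbours are linked by a walk through `U`, all of which is far from `v`, so `bypass` applies
  -- to them.
  simplicial-near : Chordal G → ∀ {U Z v} → Connected (_∈ U) →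
    (∀ {u z} → u ∈ U → z ∈ Z → ¬ Adj⁼ z u) →
    (∀ {x y z} → Any (Adj⁼ x) U → y ∈ Z → z ∈ Z → Adj G x y → Adj G x z) →
    v ∈ Z → SimplicialIn (_∈ Z) v → SimplicialIn (Near U Z) v
  simplicial-near chordal {U} {Z} {v} connected apart complete v∈Z simp = λ where
    (inj₁ x∈Z) (inj₁ y∈Z) v~x v~y → simp x∈Z y∈Z v~x v~y
    (inj₁ x∈Z) (inj₂ y≈U) v~x v~y → [ symm G (complete y≈U v∈Z x∈Z (symm G v~y)) ]
    (inj₂ x≈U) (inj₁ y∈Z) v~x v~y → [ complete x≈U v∈Z y∈Z (symm G v~x) ]
    (inj₂ x≈U) (inj₂ y≈U) v~x v~y →
      let s , s∈U , x~s = find x≈U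
          t , t∈U , y~t = find y≈U
          avoiding : ∀ {u} → u ∈ U → u ≡ _ ⊎ ¬ Adj⁼ v u
          avoiding u∈U = inj₂ (apart u∈U v∈Z)
      in bypass chordal v~x v~y
           ((avoiding s∈U , x~s) ◅ gmap id (λ (u∈U , a) → avoiding u∈U , a) (connected s∈U t∈U)
             ◅◅ (inj₁ refl , symm⁼ y~t) ◅ ε)

  Mixed : (U Z : List (Fin m)) → Pred (Fin m) 0ℓ
  Mixed U Z x = Any (Adj⁼ x) U × Any (Adj G x) Z × Any (λ z → ¬ Adj G x z) Z

  mixed? : ∀ U Z → Decidable (Mixed U Z)
  mixed? U Z x = any? (adj⁼? x) U ×-dec any? (adj? G x) Z ×-dec any? (¬? ∘ adj? G x) Z

  unmixed⇒complete : ∀ {U Z} → ¬ ∃ (Mixed U Z) → ∀ {x y z} →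
                     Any (Adj⁼ x) U → y ∈ Z → z ∈ Z → Adj G x y → Adj G x z
  unmixed⇒complete none {x} {z = z} x≈U y∈Z z∈Z x~y = decidable-stable (adj? G x z) λ ¬a →
    none (x , x≈U , lose y∈Z x~y , lose z∈Z ¬a)

  -- As long as some vertex near U has both a neighbour and a non-neighbour in Z,
  -- it is moved to U and its neighbours are dropped from Z.  When there is none,
  -- the vertices that are near U and adjacent to some vertex of Z form a clique,
  -- by bypass, and are adjacent to all of Z.
  simplicial : Chordal G → ∀ {U Z} → Acc _<_ (length Z) → Connected (_∈ U) →
    (∀ {u z} → u ∈ U → z ∈ Z → ¬ Adj⁼ z u) → ∃ (_∈ Z) →
    ∃ λ v → v ∈ Z × SimplicialIn (Near U Z) v
  simplicial chordal {U} {Z} (acc rec) connected apart (z₀ , z₀∈Z)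
    with Fin.any? (mixed? U Z)
  ... | yes (x , x≈U , hit , miss) =
    let v , v∈Z′ , simp = simplicial chordal
          (rec (filter-notAll keep? Z (Any.map (λ a ¬a → ¬a a) hit)))
          (connected-∷ connected x≈U) apart′
          (let z , z∈Z , ¬a = find miss in z , ∈-filter⁺ keep? z∈Z ¬a)
    in v , proj₁ (∈-filter⁻ keep? {xs = Z} v∈Z′) , λ p q → simp (near p) (near q)
    where
    keep? : Decidable (λ z → ¬ Adj G x z)
    keep? = ¬? ∘ adj? G x

    apart′ : ∀ {u z} → u ∈ x ∷ U → z ∈ filter keep? Z → ¬ Adj⁼ z u
    apart′ (there u∈U) z∈Z′ a     = apart u∈U (proj₁ (∈-filter⁻ keep? z∈Z′)) a
    apart′ (here refl) z∈Z′ [ a ] = proj₂ (∈-filter⁻ keep? {xs = Z} z∈Z′) (symm G a)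
    apart′ (here refl) z∈Z′ refl  =
      let u , u∈U , a = find x≈U in apart u∈U (proj₁ (∈-filter⁻ keep? z∈Z′)) a

    near : ∀ {y} → Near U Z y → Near (x ∷ U) (filter keep? Z) y
    near (inj₂ y≈U) = inj₂ (there y≈U)
    near {y} (inj₁ y∈Z) with adj? G x y
    ... | yes a = inj₂ (here [ symm G a ])
    ... | no ¬a = inj₁ (∈-filter⁺ keep? y∈Z ¬a)
  ... | no none with any? (λ v → any? (¬? ∘ adj⁼? v) Z) Z
  ...   | no ¬missing = z₀ , z₀∈Z , simplicial-near chordal connected apart (unmixed⇒complete none) z₀∈Z
            λ {x} {y} x∈Z y∈Z _ _ →
              decidable-stable (adj⁼? x y) λ ¬a → ¬missing (lose x∈Z (lose y∈Z ¬a))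
  -- Some `t` in `Z` has a non-neighbour in `Z`. The recursion starts afresh with `t` alone as `U`
  -- and with its closed neighbourhood dropped from `Z`. The new region contains all of `Z`, so the
  -- vertex found is simplicial in `Z`, and `simplicial-near` carries this over to the region of the
  -- original `U`.
  ...   | yes missing =
    let v , v∈Z′ , simp = simplicial chordal
          (rec (filter-notAll keep? Z (lose t∈Z λ ¬a → ¬a refl)))
          (λ { (here refl) (here refl) → ε })
          (λ { (here refl) z∈Z′ a → proj₂ (∈-filter⁻ keep? {xs = Z} z∈Z′) (symm⁼ a) })
          (let z , z∈Z , ¬a = find (proj₂ (proj₂ (find missing))) in z , ∈-filter⁺ keep? z∈Z ¬a)
        v∈Z = proj₁ (∈-filter⁻ keep? {xs = Z} v∈Z′)
    in v , v∈Z , simplicial-near chordal connected apart (unmixed⇒complete none) v∈Z λ p q → simp (near p) (near q)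
    where
    t = proj₁ (find missing)
    t∈Z = proj₁ (proj₂ (find missing))
    keep? : Decidable (λ z → ¬ Adj⁼ t z)
    keep? = ¬? ∘ adj⁼? t

    near : ∀ {y} → y ∈ Z → Near (t ∷ []) (filter keep? Z) y
    near {y} y∈Z with adj⁼? t y
    ... | yes a = inj₂ (here (symm⁼ a))
    ... | no ¬a = inj₁ (∈-filter⁺ keep? y∈Z ¬a)

-- Brambles in chordal graphs.

module _ {m} (G : Graph m) where
  open import Data.List.Base using ([]; _∷_)

  -- Both directions are built together because `Step` is not symmetric.
  fan : ∀ {n} (f : Fin (suc n) → Fin m) → (∀ q q′ → suc (toℕ q) ≡ toℕ q′ → Adj G (f q) (f q′)) →
        ∀ {P : Pred (Fin m) 0ℓ} → (∀ q → P (f q)) →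
        ∀ a → Star (Step G P) (f zero) (f a) × Star (Step G P) (f a) (f zero)
  fan f adj p zero = ε , ε
  fan {suc n} f adj p (suc a) =
    let out , back = fan (f ∘ suc) (λ q q′ eq → adj (suc q) (suc q′) (cong suc eq)) (p ∘ suc) a
        a₀ = adj zero (suc zero) refl
    in (p (suc zero) , [ a₀ ]) ◅ out , back ◅◅ (p zero , [ symm G a₀ ]) ◅ ε

  line-connected : ∀ {n} (f : Fin n → Fin m) → (∀ q q′ → suc (toℕ q) ≡ toℕ q′ → Adj G (f q) (f q′)) →
                   ∀ {P : Pred (Fin m) 0ℓ} → (∀ q → P (f q)) → ∀ a b → Star (Step G P) (f a) (f b)
  line-connected {suc n} f adj p a b = proj₂ (fan f adj p a) ◅◅ proj₁ (fan f adj p b)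

  -- `W` lists the vertices not yet removed, while the sets `B i` stay fixed. Touching means sharing
  -- a vertex or being joined by an edge; for `i = j` it makes each set nonempty.
  record Bramble {I : Set} (B : I → Pred (Fin m) 0ℓ) (W : List (Fin m)) : Set where
    field
      connected : ∀ i → Connected G (λ x → B i x × x ∈ W)
      touching  : ∀ i j → ∃₂ λ x y → (B i x × x ∈ W) × (B j y × y ∈ W) × Adj⁼ G x y

  CliqueCovering : {I : Set} → (I → Pred (Fin m) 0ℓ) → Set
  CliqueCovering B = ∃ λ K →
    (∀ {x y} → x ∈ K → y ∈ K → Adj⁼ G x y) × (∀ i → Any (B i) K)

  other? : ∀ (v : Fin m) → Decidable (_≢ v)
  other? v x = ¬? (x Fin.≟ v)

  module _ {W v} (simp : SimplicialIn G (_∈ W) v) where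

    without : List (Fin m)
    without = filter (other? v) W

    without⁺ : ∀ {x} → x ∈ W → x ≢ v → x ∈ without
    without⁺ = ∈-filter⁺ (other? v)

    module _ {P : Pred (Fin m) 0ℓ} where
      private
        In  = λ x → P x × x ∈ W
        In′ = λ x → P x × x ∈ without

      -- A simplicial vertex can be short-cut out of every walk.
      mutual
        avoid : ∀ {x y} → Star (Step G In) x y → x ∈ W → x ≢ v → y ≢ v → Star (Step G In′) x y
        avoid ε _ _ _ = ε
        avoid (_◅_ {j = t} ((p , t∈W) , a) walk) x∈W x≢v y≢v with t Fin.≟ v
        ... | no t≢v = ((p , without⁺ t∈W t≢v) , a) ◅ avoid walk t∈W t≢v y≢v
        avoid (((p , t∈W) , refl)  ◅ walk) x∈W x≢v y≢v | yes refl = contradiction refl x≢v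
        avoid (((p , t∈W) , [ a ]) ◅ walk) x∈W x≢v y≢v | yes refl = shortcut walk x∈W x≢v (symm G a) y≢v

        shortcut : ∀ {x y} → Star (Step G In) v y → x ∈ W → x ≢ v → Adj G v x → y ≢ v →
                   Star (Step G In′) x y
        shortcut ε _ _ _ y≢v = contradiction refl y≢v
        shortcut (((p , t∈W) , refl) ◅ walk) x∈W x≢v a y≢v = shortcut walk x∈W x≢v a y≢v
        shortcut (((p , t∈W) , [ b ]) ◅ walk) x∈W x≢v a y≢v =
          ((p , without⁺ t∈W t≢v) , simp x∈W t∈W a b) ◅ avoid walk t∈W t≢v y≢v
          where t≢v = λ t≡v → irrefl G (sym t≡v) b

      neighbour : ∀ {y} → Star (Step G In) v y → y ≢ v → ∃ λ x → In′ x × Adj G v x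
      neighbour ε y≢v = contradiction refl y≢v
      neighbour ((_ , refl) ◅ walk) y≢v = neighbour walk y≢v
      neighbour (((p , t∈W) , [ a ]) ◅ _) y≢v = _ , (p , without⁺ t∈W (λ t≡v → irrefl G (sym t≡v) a)) , a

    without⁻ : ∀ {x} → x ∈ without → x ∈ W × x ≢ v
    without⁻ = ∈-filter⁻ (other? v)

    -- Connectedness survives by `avoid`. Where `v` takes part in a touching pair, it is replaced by
    -- a neighbour in the same set; neighbours of a simplicial vertex are equal or adjacent, so the
    -- sets still touch.
    bramble-without : {I : Set} {B : I → Pred (Fin m) 0ℓ} → Bramble B W →
                      (∀ i → ∃ λ u → B i u × u ∈ W × u ≢ v) → Bramble B without
    bramble-without {B = B} bramble other = record
      { connected = λ i (p , x∈) (q , y∈) →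
          let x∈W , x≢v = without⁻ x∈
              y∈W , y≢v = without⁻ y∈
          in avoid (connected i (p , x∈W) (q , y∈W)) x∈W x≢v y≢v
      ; touching = touching′
      }
      where
      open Bramble bramble

      move : ∀ {x} i → B i x → x ∈ W →
             ∃ λ x′ → (B i x′ × x′ ∈ without) × (x ≡ x′ ⊎ x ≡ v × Adj G v x′)
      move {x} i p x∈W with x Fin.≟ v
      ... | no x≢v = x , (p , without⁺ x∈W x≢v) , inj₁ refl
      ... | yes refl =
        let u , q , u∈W , u≢v = other i
            x′ , in′ , a = neighbour (connected i (p , x∈W) (q , u∈W)) u≢v
        in x′ , in′ , inj₂ (refl , a)

      adj-moved : ∀ {x y x′ y′} → x′ ∈ without → y′ ∈ without → Adj⁼ G x y →
                  x ≡ x′ ⊎ x ≡ v × Adj G v x′ → y ≡ y′ ⊎ y ≡ v × Adj G v y′ → Adj⁼ G x′ y′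
      adj-moved x′∈ y′∈ a (inj₁ refl) (inj₁ refl) = a
      adj-moved x′∈ y′∈ refl (inj₁ refl) (inj₂ (refl , c)) = [ c ]
      adj-moved x′∈ y′∈ [ a ] (inj₁ refl) (inj₂ (refl , c)) =
        simp (proj₁ (without⁻ x′∈)) (proj₁ (without⁻ y′∈)) (symm G a) c
      adj-moved x′∈ y′∈ refl (inj₂ (refl , b)) (inj₁ refl) = [ symm G b ]
      adj-moved x′∈ y′∈ [ a ] (inj₂ (refl , b)) (inj₁ refl) =
        simp (proj₁ (without⁻ x′∈)) (proj₁ (without⁻ y′∈)) b a
      adj-moved x′∈ y′∈ a (inj₂ (_ , b)) (inj₂ (_ , c)) =
        simp (proj₁ (without⁻ x′∈)) (proj₁ (without⁻ y′∈)) b c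

      touching′ : ∀ i j → ∃₂ λ x y → (B i x × x ∈ without) × (B j y × y ∈ without) × Adj⁼ G x y
      touching′ i j =
        let x , y , (p , x∈W) , (q , y∈W) , a = touching i j
            x′ , inx , mx = move i p x∈W
            y′ , iny , my = move j q y∈W
        in x′ , y′ , inx , iny , adj-moved (proj₂ inx) (proj₂ iny) a mx my

  -- `search` stands for finiteness of the index set: it decides whether some set has no vertex of
  -- `W` left other than `v`.
  bramble⇒clique : Chordal G → {I : Set} → (∀ {P : Pred I 0ℓ} → Decidable P → Dec (∃ P)) →
    {B : I → Pred (Fin m) 0ℓ} → (∀ i → Decidable (B i)) →
    ∀ {W} → Acc _<_ (length W) → Bramble B W → CliqueCovering B
  bramble⇒clique chordal search {B} B? {[]} _ bramble =
    -- Each set touches itself and so has a vertex in `W`; with `W` empty there are no sets to meet.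
    [] , (λ ()) , λ i → let _ , _ , (_ , x∈[]) , _ = Bramble.touching bramble i i in contradiction x∈[] λ ()
  bramble⇒clique chordal search {B} B? {W@(w ∷ _)} (acc rec) bramble
    -- With `U` empty the region is `W` itself: this is Dirac's theorem for the subgraph induced on
    -- `W`.
    with v , v∈W , simp₀ ← simplicial G chordal {U = []} {Z = W} (<-wellFounded _) (λ ()) (λ ()) (w , here refl)
    with search (λ i → ¬? (any? (λ u → B? i u ×-dec other? v u) W))
  ... | no none = bramble⇒clique chordal search B?
          (rec (filter-notAll (other? v) W (lose v∈W λ v≢v → v≢v refl)))
          (bramble-without {W = W} simp bramble λ i →
            let hit = decidable-stable (any? (λ u → B? i u ×-dec other? v u) W) λ ¬hit → none (i , ¬hit)
                u , u∈W , p , u≢v = find hit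
            in u , p , u∈W , u≢v)
    where
    simp : SimplicialIn G (_∈ W) v
    simp x∈W y∈W = simp₀ (inj₁ x∈W) (inj₁ y∈W)
  -- Within `W` the set `B i` is just `v`, so every set, touching `B i`, contains `v` or a neighbour
  -- of `v`.
  ... | yes (i , lone) = v ∷ filter (adj? G v) W , clique , meets
    where
    clique : ∀ {x y} → x ∈ v ∷ filter (adj? G v) W → y ∈ v ∷ filter (adj? G v) W → Adj⁼ G x y
    clique (here refl) (here refl) = refl
    clique (here refl) (there y∈N) = [ proj₂ (∈-filter⁻ (adj? G v) {xs = W} y∈N) ]
    clique (there x∈N) (here refl) = [ symm G (proj₂ (∈-filter⁻ (adj? G v) {xs = W} x∈N)) ]
    clique (there x∈N) (there y∈N) =
      let x∈W , a = ∈-filter⁻ (adj? G v) x∈N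
          y∈W , b = ∈-filter⁻ (adj? G v) y∈N
      in simp₀ (inj₁ x∈W) (inj₁ y∈W) a b

    meets : ∀ j → Any (B j) (v ∷ filter (adj? G v) W)
    meets j with Bramble.touching bramble i j
    ... | x , y , (p , x∈W) , (q , y∈W) , a
      with decidable-stable (x Fin.≟ v) (λ x≢v → lone (lose x∈W (p , x≢v))) | a
    ... | refl | refl  = here q
    ... | refl | [ b ] = there (lose (∈-filter⁺ (adj? G v) y∈W b) q)

-- Distances between classes of adjacent vertices.

max-upper : ∀ {n} (f : Vector ℕ n) i → f i ≤ max f
max-upper f zero    = ℕ.m≤m⊔n _ _
max-upper f (suc i) = ℕ.≤-trans (max-upper (f ∘ suc) i) (ℕ.m≤n⊔m _ _)

width-upper : ∀ {m t} (G : Graph m) (C : Fin m → Fin t) {x y} → Adj G x y →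
              ∣ toℕ (C y) - toℕ (C x) ∣ ≤ width G C
width-upper G C {x} {y} a = begin
  ∣ toℕ (C y) - toℕ (C x) ∣
    ≡⟨ cong (if_then ∣ toℕ (C y) - toℕ (C x) ∣ else 0) (dec-true (adj? G x y) a) ⟨
  (if does (adj? G x y) then ∣ toℕ (C y) - toℕ (C x) ∣ else 0)
    ≤⟨ max-upper _ y ⟩
  max (λ y → if does (adj? G x y) then ∣ toℕ (C y) - toℕ (C x) ∣ else 0)
    ≤⟨ max-upper _ x ⟩
  width G C ∎
  where open ℕ.≤-Reasoning

-- Crosses of the grid and a sparse clique.

Grid : ℕ → Set
Grid n = Fin n × Fin n

distance : ∀ {n} → Grid n → Grid n → ℕ
distance (a , b) (a′ , b′) = ∣ toℕ a - toℕ a′ ∣ + ∣ toℕ b - toℕ b′ ∣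

double : ∀ n → Fin ⌈ n /2⌉ → Fin n
double (suc zero)    zero    = zero
double (suc (suc n)) zero    = zero
double (suc (suc n)) (suc i) = suc (suc (double n i))

toℕ-double : ∀ n i → toℕ (double n i) ≡ 2 * toℕ i
toℕ-double (suc zero)    zero    = refl
toℕ-double (suc (suc n)) zero    = refl
toℕ-double (suc (suc n)) (suc i) =
  trans (cong (2 +_) (toℕ-double n i)) (sym (ℕ.*-suc 2 (toℕ i)))

double-far : ∀ n {i j} → i ≢ j → 2 ≤ ∣ toℕ (double n i) - toℕ (double n j) ∣
double-far n {i} {j} i≢j rewrite toℕ-double n i | toℕ-double n j
                               | sym (ℕ.*-distribˡ-∣-∣ 2 (toℕ i) (toℕ j)) =
  ℕ.*-monoʳ-≤ 2 (ℕ.n≢0⇒n>0 (i≢j ∘ Fin.toℕ-injective ∘ ℕ.∣m-n∣≡0⇒m≡n))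

module _ {m n} (H : Graph m) (grid : Grid n → Fin m)
         (grid-adj : ∀ {p q} → GridAdj p q → Adj H (grid p) (grid q)) where

  Row Column : Fin n → Pred (Fin m) 0ℓ
  Row    i x = ∃ λ q → x ≡ grid (i , q)
  Column j x = ∃ λ q → x ≡ grid (q , j)

  row? : ∀ i → Decidable (Row i)
  row? i x = Fin.any? λ q → x Fin.≟ grid (i , q)

  column? : ∀ j → Decidable (Column j)
  column? j x = Fin.any? λ q → x Fin.≟ grid (q , j)

  Cross : Grid n → Pred (Fin m) 0ℓ
  Cross (i , j) x = Row i x ⊎ Column j x

  ∣n-1+n∣≡1 : ∀ {q q′} → suc q ≡ q′ → ∣ q - q′ ∣ ≡ 1
  ∣n-1+n∣≡1 {q} refl = trans (cong ∣ q -_∣ (ℕ.+-comm 1 q)) (ℕ.∣m-m+n∣≡n q 1)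

  row-step : ∀ i (q q′ : Fin n) → suc (toℕ q) ≡ toℕ q′ → Adj H (grid (i , q)) (grid (i , q′))
  row-step i q q′ eq = grid-adj (cong₂ _+_ (ℕ.∣n-n∣≡0 (toℕ i)) (∣n-1+n∣≡1 eq))

  column-step : ∀ j (q q′ : Fin n) → suc (toℕ q) ≡ toℕ q′ → Adj H (grid (q , j)) (grid (q′ , j))
  column-step j q q′ eq = grid-adj (cong₂ _+_ (∣n-1+n∣≡1 eq) (ℕ.∣n-n∣≡0 (toℕ j)))

  -- Within a cross every walk can go through the centre. Two crosses share the vertex where the row
  -- of the first meets the column of the second.
  cross-bramble : Bramble H Cross (allFin m)
  cross-bramble = record
    { connected = λ (i , j) (p , _) (q , _) → proj₁ (centre i j p) ◅◅ proj₂ (centre i j q)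
    ; touching  = λ (i , j) (i′ , j′) → grid (i , j′) , grid (i , j′) ,
        (inj₁ (j′ , refl) , ∈-allFin _) , (inj₂ (i , refl) , ∈-allFin _) , refl
    }
    where
    centre : ∀ i j {x} → Cross (i , j) x →
             let Walk = Star (Step H λ y → Cross (i , j) y × y ∈ allFin m)
             in Walk x (grid (i , j)) × Walk (grid (i , j)) x
    centre i j (inj₁ (q , refl)) = line q j , line j q
      where line = line-connected H (λ q → grid (i , q)) (row-step i) λ q → inj₁ (q , refl) , ∈-allFin _
    centre i j (inj₂ (q , refl)) = line q i , line i q
      where line = line-connected H (λ q → grid (q , j)) (column-step j) λ q → inj₂ (q , refl) , ∈-allFin _

  -- A set that misses some row and some column misses their cross, so the clique
  -- meets all rows or all columns; take every other one of them.
  chordal⇒sparse-clique : Chordal H → ∃ λ (s : Fin ⌈ n /2⌉ → Grid n) →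
    (∀ a b → Adj⁼ H (grid (s a)) (grid (s b))) × (∀ {a b} → a ≢ b → 2 ≤ distance (s a) (s b))
  chordal⇒sparse-clique chordal
    with K , clique , meets ← bramble⇒clique H chordal
           (λ P? → map′ (λ (i , j , p) → (i , j) , p) (λ ((i , j) , p) → i , j , p)
             (Fin.any? λ i → Fin.any? λ j → P? (i , j)))
           {B = Cross} (λ (i , j) x → row? i x ⊎-dec column? j x) (<-wellFounded _) cross-bramble
    with Fin.all? (λ i → any? (row? i) K)
  ... | yes rows = (λ a → double n a , proj₁ (hit a)) , (λ a b → clique (in-K a) (in-K b)) ,
                   λ i≢j → ℕ.≤-trans (double-far n i≢j) (ℕ.m≤m+n _ _)
    where
    hit : ∀ a → ∃ λ q → grid (double n a , q) ∈ K
    hit a with _ , x∈K , q , refl ← find (rows (double n a)) = q , x∈K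
    in-K = proj₂ ∘ hit
  ... | no ¬rows = (λ a → proj₁ (hit a) , double n a) , (λ a b → clique (in-K a) (in-K b)) ,
                   λ i≢j → ℕ.≤-trans (double-far n i≢j) (ℕ.m≤n+m _ _)
    where
    missed = Fin.¬∀⟶∃¬ n _ (λ i → any? (row? i) K) ¬rows
    hit : ∀ a → ∃ λ q → grid (q , double n a) ∈ K
    hit a with find (meets (proj₁ missed , double n a))
    ... | _ , x∈K , inj₁ row        = contradiction (lose x∈K row) (proj₂ missed)
    ... | _ , x∈K , inj₂ (q , refl) = q , x∈K
    in-K = proj₂ ∘ hit

-- Counting vertices by their offsets in the clique covers.

module _ (M c : ℕ) where

  -- The signed difference of `u` and `c`, shifted by `M` to become a natural number. The truncated
  -- subtraction is exact, as `c ≤ u + M`.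
  offset : ∀ u → ∣ c - u ∣ ≤ M → Fin (suc (2 * M))
  offset u near = fromℕ< {u + M ∸ c} (s≤s (begin
    u + M ∸ c             ≤⟨ ℕ.∸-monoˡ-≤ c (ℕ.+-monoˡ-≤ M (ℕ.m≤n+∣n-m∣ u c)) ⟩
    c + ∣ c - u ∣ + M ∸ c ≡⟨ cong (_∸ c) (ℕ.+-assoc c _ M) ⟩
    c + (∣ c - u ∣ + M) ∸ c ≡⟨ ℕ.m+n∸m≡n c _ ⟩
    ∣ c - u ∣ + M         ≤⟨ ℕ.+-mono-≤ near (ℕ.m≤m+n M 0) ⟩
    2 * M                 ∎))
    where open ℕ.≤-Reasoning

  offset-injective : ∀ u v (p : ∣ c - u ∣ ≤ M) (q : ∣ c - v ∣ ≤ M) → offset u p ≡ offset v q → u ≡ v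
  offset-injective u v p q eq =
    ℕ.+-cancelʳ-≡ M u v (ℕ.∸-cancelʳ-≡ (reach p) (reach q) (Fin.fromℕ<-injective _ _ _ _ eq))
    where
    reach : ∀ {u} → ∣ c - u ∣ ≤ M → c ≤ u + M
    reach {u} p = ℕ.≤-trans (ℕ.m≤n+∣m-n∣ c u) (ℕ.+-monoʳ-≤ u p)

-- A vertex of s is coded by its r offsets from the class of x, each of which is at
-- most M in absolute value.  Vertices with equal codes share a class in every Gs i.
code-bound : ∀ {m r M N} (Gs : Fin r → Graph m) → (∀ i → ccw (Gs i) ≤ M) →
  ∀ x (s : Fin N → Fin m) → (∀ i a → Adj (Gs i) (s a) x) →
  (∀ {a b} → a ≢ b → s a ≢ s b × ¬ (∀ i → Adj (Gs i) (s a) (s b))) → N ≤ suc (2 * M) ^ r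
code-bound {m} {r} {M} {N} Gs bound x s star independent = Fin.injective⇒≤ {f = code} injective
  where
  cover : ∀ i → HasCoverOfWidth (Gs i) (ccw (Gs i))
  cover i = proj₁ (ccw-isMinimum (Gs i))

  class : ∀ i → Fin m → ℕ
  class i = toℕ ∘ proj₁ (proj₂ (cover i))

  near : ∀ i a → ∣ class i x - class i (s a) ∣ ≤ M
  near i a with t , C , _ , eq ← cover i =
    ℕ.≤-trans (width-upper (Gs i) C (star i a)) (ℕ.≤-trans (ℕ.≤-reflexive eq) (bound i))

  digit : Fin N → Fin r → Fin (suc (2 * M))
  digit a i = offset M (class i x) (class i (s a)) (near i a)

  code : Fin N → Fin (suc (2 * M) ^ r)
  code a = funToFin (digit a)

  injective : ∀ {a b} → code a ≡ code b → a ≡ b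
  injective {a} {b} eq = decidable-stable (a Fin.≟ b) λ a≢b →
    proj₂ (independent a≢b) λ i →
      let _ , _ , (_ , clique) , _ = cover i in
      clique _ _ (proj₁ (independent a≢b)) (Fin.toℕ-injective (offset-injective M (class i x) _ _ (near i a) (near i b)
        (trans (sym (Fin.finToFun-funToFin (digit a) i))
          (trans (cong (λ e → finToFun e i) eq) (Fin.finToFun-funToFin (digit b) i)))))

-- The lower bound of (i).

^-distribʳ-* : ∀ m n o → (m * n) ^ o ≡ m ^ o * n ^ o
^-distribʳ-* m n zero    = refl
^-distribʳ-* m n (suc o) =
  trans (cong (m * n *_) (^-distribʳ-* m n o)) (ℕ.[m*n]*[o*p]≡[m*o]*[n*p] m n (m ^ o) (n ^ o))

-- The case `M = 0` would give `⌈ n /2⌉ ≤ 1`, which `3 ≤ n` excludes. Otherwise `2M + 1 ≤ 3M`, and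
-- the factor 2 lost in halving `n` is at most `2 ^ r`; together they make the constant 6.
half-bound⇒root-bound : ∀ {n r M} → 3 ≤ n → 1 ≤ r → ⌈ n /2⌉ ≤ suc (2 * M) ^ r →
                        M ≥[ 1 / 6 ]·root[ r ] n
half-bound⇒root-bound {n} {r} {zero} 3≤n _ le =
  contradiction (ℕ.≤-trans (ℕ.⌈n/2⌉-mono 3≤n) (ℕ.≤-trans le (ℕ.≤-reflexive (ℕ.^-zeroˡ r)))) λ { (s≤s ()) }
half-bound⇒root-bound {n} {suc r} {M@(suc _)} _ _ le = begin
  1 ^ suc r * n               ≡⟨ cong (_* n) (ℕ.^-zeroˡ (suc r)) ⟩
  1 * n                       ≡⟨ ℕ.*-identityˡ n ⟩
  n                           ≡⟨ ℕ.⌊n/2⌋+⌈n/2⌉≡n n ⟨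
  ⌊ n /2⌋ + ⌈ n /2⌉           ≤⟨ ℕ.+-mono-≤ (ℕ.⌊n/2⌋≤⌈n/2⌉ n) (ℕ.m≤m+n _ 0) ⟩
  2 * ⌈ n /2⌉                 ≤⟨ ℕ.*-mono-≤ (ℕ.m≤m*n 2 (2 ^ r) {{ℕ.m^n≢0 2 r}}) le ⟩
  2 ^ suc r * suc (2 * M) ^ suc r
    ≤⟨ ℕ.*-monoʳ-≤ (2 ^ suc r) (ℕ.^-monoˡ-≤ (suc r) (ℕ.+-monoˡ-≤ (2 * M) (s≤s z≤n))) ⟩
  2 ^ suc r * (3 * M) ^ suc r ≡⟨ ^-distribʳ-* 2 (3 * M) (suc r) ⟨
  (2 * (3 * M)) ^ suc r       ≡⟨ cong (_^ suc r) (ℕ.*-assoc 2 3 M) ⟨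
  (6 * M) ^ suc r             ∎
  where open ℕ.≤-Reasoning

grid-injective : ∀ {k n m} {G : Graph m} (g : Ĝ k n G) → ∀ {p q} → Ĝ.grid g p ≡ Ĝ.grid g q → p ≡ q
grid-injective g eq = inj₁-injective
  (trans (sym (strictlyInverseˡ _)) (trans (cong to eq) (strictlyInverseˡ _)))
  where open Inverse (Ĝ.vertices g)

adj⁼⇒adj : ∀ {m} (H : Graph m) {u v} → u ≢ v → Adj⁼ H u v → Adj H u v
adj⁼⇒adj H u≢v refl  = contradiction refl u≢v
adj⁼⇒adj H u≢v [ a ] = a

distance-refl : ∀ {n} (p : Grid n) → distance p p ≡ 0
distance-refl (a , b) = cong₂ _+_ (ℕ.∣n-n∣≡0 (toℕ a)) (ℕ.∣n-n∣≡0 (toℕ b))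

lower-bound : ∀ n k r → 3 ≤ n → 1 ≤ k → 1 ≤ r → ∀ {m} (G : Graph m) → Ĝ k n G →
  (Gs : Fin (suc r) → Graph m) → Chordal (Gs zero) → G IsIntersectionOf Gs →
  max (λ i → ccw (Gs (suc i))) ≥[ 1 / 6 ]·root[ r ] n
lower-bound n (suc k) r 3≤n _ 1≤r G g Gs chordal inter =
  half-bound⇒root-bound {M = max (ccw ∘ Gs ∘ suc)} 3≤n 1≤r
    -- Since `k` is positive there is a vertex `new zero`; it is joined to every grid vertex in `G`,
    -- hence in each `Gs i`.
    (code-bound (Gs ∘ suc) (max-upper (ccw ∘ Gs ∘ suc)) (new zero) (grid ∘ s)
      (λ i a → to (inter _ _) (symm G (join-edges zero (s a))) (suc i))
      (λ a≢b → distinct a≢b , nonadjacent a≢b))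
  where
  open Ĝ g
  open Equivalence
  sparse = chordal⇒sparse-clique (Gs zero) grid
             (λ {p} {q} a → to (inter _ _) (from (grid-edges p q) a) zero) chordal
  s      = proj₁ sparse
  clique = proj₁ (proj₂ sparse)

  far : ∀ {a b} → a ≢ b → 2 ≤ distance (s a) (s b)
  far = proj₂ (proj₂ sparse)

  distinct : ∀ {a b} → a ≢ b → grid (s a) ≢ grid (s b)
  distinct {a} {b} a≢b eq = contradiction
    (subst (2 ≤_) (trans (cong (distance (s a)) (sym (grid-injective g eq))) (distance-refl (s a))) (far a≢b))
    λ ()

  -- The clique provides the edge in `Gs zero`, so edges in all the others would give an edge of `G`
  -- between grid vertices at distance at least 2.
  nonadjacent : ∀ {a b} → a ≢ b → ¬ (∀ i → Adj (Gs (suc i)) (grid (s a)) (grid (s b)))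
  nonadjacent {a} {b} a≢b adj = ℕ.<⇒≢ (far a≢b) (sym (to (grid-edges (s a) (s b)) (from (inter _ _) λ where
    zero    → adj⁼⇒adj (Gs zero) (distinct a≢b) (clique a b)
    (suc i) → adj i)))

-- Bounding the clique cover width from above.

max-least : ∀ {n M} (f : Vector ℕ n) → (∀ i → f i ≤ M) → max f ≤ M
max-least {zero}  f bound = z≤n
max-least {suc n} f bound = ℕ.⊔-lub (bound zero) (max-least (f ∘ suc) (bound ∘ suc))

width-least : ∀ {m t M} (G : Graph m) (C : Fin m → Fin t) →
              (∀ x y → Adj G x y → ∣ toℕ (C y) - toℕ (C x) ∣ ≤ M) → width G C ≤ M
width-least {M = M} G C bound = max-least _ λ x → max-least _ λ y → entry x y
  where
  entry : ∀ x y → (if does (adj? G x y) then ∣ toℕ (C y) - toℕ (C x) ∣ else 0) ≤ M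
  entry x y with adj? G x y
  ... | yes a = bound x y a
  ... | no  _ = z≤n

ccw-least : ∀ {m t M} (G : Graph m) (C : Fin m → Fin t) → IsCliqueCover G C →
            (∀ x y → Adj G x y → ∣ toℕ (C y) - toℕ (C x) ∣ ≤ M) → ccw G ≤ M
ccw-least G C cover bound =
  ℕ.≤-trans (proj₂ (ccw-isMinimum G) (width G C) (_ , C , cover , refl)) (width-least G C bound)

-- Chordality from an elimination order.

next : ∀ {ℓ} (i : Fin ℓ) → ∃ λ j → Next i j
next {suc ℓ} i with suc (toℕ i) ℕ.<? suc ℓ
... | yes i<ℓ = fromℕ< i<ℓ , inj₁ (sym (Fin.toℕ-fromℕ< i<ℓ))
... | no  i≮ℓ = zero , inj₂ (ℕ.≤-antisym (Fin.toℕ<n i) (ℕ.≮⇒≥ i≮ℓ) , refl)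

previous : ∀ {ℓ} (i : Fin ℓ) → ∃ λ j → Next j i
previous {suc ℓ} zero    = fromℕ ℓ , inj₂ (cong suc (Fin.toℕ-fromℕ ℓ) , refl)
previous {suc ℓ} (suc i) = inject₁ i , inj₁ (cong suc (Fin.toℕ-inject₁ i))

-- Any coincidence that is not contradictory in itself forces `ℓ` to be 1, 2 or 3.
around-apart : ∀ {ℓ} → 4 ≤ ℓ → ∀ {i j k : Fin ℓ} → Next i j → Next j k →
               i ≢ k × ¬ (Next i k ⊎ Next k i)
around-apart {ℓ} 4≤ℓ {i} {j} {k} ij jk =
  proj₁ (apart (toℕ i) (toℕ j) (toℕ k) ij jk) ∘ cong toℕ , proj₂ (apart (toℕ i) (toℕ j) (toℕ k) ij jk)
  where
  Nx : ℕ → ℕ → Set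
  Nx x y = suc x ≡ y ⊎ (suc x ≡ ℓ × y ≡ 0)
  small : ∀ {x} → x < 4 → x ≢ ℓ
  small x<4 x≡ℓ = ℕ.<⇒≢ (ℕ.<-≤-trans x<4 4≤ℓ) x≡ℓ
  apart : ∀ x y z → Nx x y → Nx y z → x ≢ z × ¬ (Nx x z ⊎ Nx z x)
  apart x y z (inj₁ refl) (inj₁ refl) = (λ ()) , λ where
    (inj₁ (inj₁ ()))
    (inj₁ (inj₂ (_ , ())))
    (inj₂ (inj₁ ()))
    (inj₂ (inj₂ (eq , refl))) → small (ℕ.≤-refl {4}) eq
  apart x y z (inj₁ refl) (inj₂ (last , refl)) = (λ where refl → small (s≤s (s≤s (s≤s z≤n))) last) , λ where
    (inj₁ (inj₁ ()))
    (inj₁ (inj₂ (last′ , _))) → ℕ.1+n≢n (trans last (sym last′))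
    (inj₂ (inj₁ refl)) → small (ℕ.≤-refl {4}) last
    (inj₂ (inj₂ (eq , _))) → small (s≤s (s≤s z≤n)) eq
  apart x y z (inj₂ (last , refl)) (inj₁ refl) = (λ where refl → small (s≤s (s≤s (s≤s z≤n))) last) , λ where
    (inj₁ (inj₁ refl)) → small (s≤s (s≤s z≤n)) last
    (inj₁ (inj₂ (_ , ())))
    (inj₂ (inj₁ refl)) → small (ℕ.≤-refl {4}) last
    (inj₂ (inj₂ (eq , _))) → small (s≤s (s≤s (s≤s z≤n))) eq
  apart x y z (inj₂ (_ , refl)) (inj₂ (eq , _)) = contradiction eq (small (s≤s (s≤s z≤n)))

-- The cycle vertex with the least key is simplicial among the cycle vertices.
key⇒chordal : ∀ {m} (G : Graph m) (key : Fin m → ℕ) →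
  (∀ {u v w} → key u ≤ key v → key u ≤ key w → Adj G u v → Adj G u w → Adj⁼ G v w) → Chordal G
key⇒chordal G key simp ℓ@(suc _) 4≤ℓ c (injective , adj) =
  let i = argmin (key ∘ c) zero (allFin ℓ)
      least = λ j → All.lookup (f[argmin]≤f[xs] {f = key ∘ c} zero (allFin ℓ)) (∈-allFin j)
      p , p→i = previous i
      q , i→q = next i
      p≢q , ¬next = around-apart 4≤ℓ p→i i→q
  in ¬next (Equivalence.to (adj p q)
       (adj⁼⇒adj G (p≢q ∘ injective)
         (simp (least p) (least q)
           (Equivalence.from (adj i p) (inj₂ p→i)) (Equivalence.from (adj i q) (inj₁ i→q)))))

∣-∣-least : ∀ {a b o} → a ≤ b + o → b ≤ a + o → ∣ a - b ∣ ≤ o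
∣-∣-least {a} {b} {o} p q with ℕ.∣m-n∣≡[m∸n]∨[n∸m] a b
... | inj₁ eq = ℕ.≤-trans (ℕ.≤-reflexive eq) (ℕ.m≤n+o⇒m∸n≤o a b p)
... | inj₂ eq = ℕ.≤-trans (ℕ.≤-reflexive eq) (ℕ.m≤n+o⇒m∸n≤o b a q)

open import Data.Vec.Functional using (_∷_; [])

-- For `n ≥ 2` the right-hand side is at least 1. For `n = 1` it is 0, but then there is only one
-- column.
half-spread : ∀ {n} (b b′ : Fin n) → ∣ toℕ b - toℕ b′ ∣ ≤ 1 → ∣ toℕ b - toℕ b′ ∣ ≤ ⌊ n /2⌋
half-spread {suc zero}    zero zero _    = z≤n
half-spread {suc (suc n)} b    b′   near = ℕ.≤-trans near (s≤s z≤n)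

-- Rows, columns and the order of the classes.

module Labels (k n : ℕ) where
  Label : Set
  Label = Grid n ⊎ Fin k

  CloseRows : Rel Label 0ℓ
  CloseRows (inj₁ (a , _)) (inj₁ (a′ , _)) = ∣ toℕ a - toℕ a′ ∣ ≤ 1
  CloseRows _              _               = ⊤

  closeRows? : B.Decidable CloseRows
  closeRows? (inj₁ _) (inj₁ _) = _ ℕ.≤? _
  closeRows? (inj₁ _) (inj₂ _) = yes tt
  closeRows? (inj₂ _) _        = yes tt

  closeRows-symm : B.Symmetric CloseRows
  closeRows-symm {inj₁ (a , _)} {inj₁ (a′ , _)} = subst (_≤ 1) (ℕ.∣-∣-comm (toℕ a) (toℕ a′))
  closeRows-symm {inj₁ _} {inj₂ _} _ = tt
  closeRows-symm {inj₂ _} {inj₁ _} _ = tt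
  closeRows-symm {inj₂ _} {inj₂ _} _ = tt

  SameColumn : Rel Label 0ℓ
  SameColumn (inj₁ (_ , b)) (inj₁ (_ , b′)) = b ≡ b′
  SameColumn _              _               = ⊥

  sameColumn? : B.Decidable SameColumn
  sameColumn? (inj₁ _) (inj₁ _) = _ Fin.≟ _
  sameColumn? (inj₁ _) (inj₂ _) = no λ ()
  sameColumn? (inj₂ _) _        = no λ ()

  sameColumn-symm : B.Symmetric SameColumn
  sameColumn-symm {inj₁ _} {inj₁ _} = sym

  -- The value `n` exceeds every row, so a new vertex never precedes a grid vertex in the
  -- elimination order.
  rowKey : Label → ℕ
  rowKey (inj₁ (a , _)) = toℕ a
  rowKey (inj₂ _)       = n

  -- If all three are grid vertices, the rows of `l₁` and `l₂` both equal that of `l` or the one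
  -- after it.
  rowKey-simplicial : ∀ l l₁ l₂ → rowKey l ≤ rowKey l₁ → rowKey l ≤ rowKey l₂ →
                      CloseRows l l₁ → CloseRows l l₂ → CloseRows l₁ l₂
  rowKey-simplicial (inj₁ (a , _)) (inj₁ (b , _)) (inj₁ (c , _)) a≤b a≤c ab ac =
    ∣-∣-least (reach ab a≤c) (reach ac a≤b)
    where
    reach : ∀ {b c} → ∣ toℕ a - b ∣ ≤ 1 → toℕ a ≤ c → b ≤ c + 1
    reach {b} ab a≤c = ℕ.≤-trans (ℕ.m≤n+∣n-m∣ b (toℕ a)) (ℕ.+-mono-≤ a≤c ab)
  rowKey-simplicial (inj₂ _) (inj₁ (b , _)) (inj₁ _) n≤b _ _ _ = contradiction (Fin.toℕ<n b) (ℕ.≤⇒≯ n≤b)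
  rowKey-simplicial _ (inj₁ _) (inj₂ _) _ _ _ _ = tt
  rowKey-simplicial _ (inj₂ _) _        _ _ _ _ = tt

  h : ℕ
  h = ⌊ n /2⌋

  n≤1+h+h : n ≤ suc (h + h)
  n≤1+h+h = begin
    n               ≡⟨ ℕ.⌊n/2⌋+⌈n/2⌉≡n n ⟨
    h + ⌈ n /2⌉     ≤⟨ ℕ.+-monoʳ-≤ h (half n) ⟩
    h + suc h       ≡⟨ ℕ.+-suc h h ⟩
    suc (h + h)     ∎
    where
    open ℕ.≤-Reasoning
    half : ∀ n → ⌈ n /2⌉ ≤ suc ⌊ n /2⌋
    half zero          = z≤n
    half (suc zero)    = s≤s z≤n
    half (suc (suc n)) = s≤s (half n)

  -- The order of the classes: the first h columns, the new vertices one by one,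
  -- the remaining columns.
  columnPosition : ℕ → ℕ
  columnPosition b with b ℕ.<? h
  ... | yes _ = b
  ... | no  _ = b + k

  data ColumnView (b : ℕ) : ℕ → Set where
    left  : b < h → ColumnView b b
    right : h ≤ b → ColumnView b (b + k)

  columnView : ∀ b → ColumnView b (columnPosition b)
  columnView b with b ℕ.<? h
  ... | yes b<h = left b<h
  ... | no  b≮h = right (ℕ.≮⇒≥ b≮h)

  position : Label → ℕ
  position (inj₁ (_ , b)) = columnPosition (toℕ b)
  position (inj₂ x)       = h + toℕ x

  position< : ∀ l → position l < n + k
  position< (inj₁ (_ , b)) with columnPosition (toℕ b) | columnView (toℕ b)
  ... | _ | left _  = ℕ.m≤n⇒m≤n+o k (Fin.toℕ<n b)
  ... | _ | right _ = ℕ.+-monoˡ-< k (Fin.toℕ<n b)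
  position< (inj₂ x) = ℕ.+-mono-≤-< (ℕ.⌊n/2⌋≤n n) (Fin.toℕ<n x)

  columnPosition-injective : ∀ b b′ → columnPosition b ≡ columnPosition b′ → b ≡ b′
  columnPosition-injective b b′ eq
    with columnPosition b | columnView b | columnPosition b′ | columnView b′
  ... | _ | left _    | _ | left _     = eq
  ... | _ | right _   | _ | right _    = ℕ.+-cancelʳ-≡ k b b′ eq
  ... | _ | left b<h  | _ | right h≤b′ = contradiction eq (ℕ.<⇒≢ (ℕ.<-≤-trans b<h (ℕ.m≤n⇒m≤n+o k h≤b′)))
  ... | _ | right h≤b | _ | left b′<h  =
    contradiction (sym eq) (ℕ.<⇒≢ (ℕ.<-≤-trans b′<h (ℕ.m≤n⇒m≤n+o k h≤b)))

  columnPosition-misses : ∀ b {x} → x < k → columnPosition b ≢ h + x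
  columnPosition-misses b {x} x<k with columnPosition b | columnView b
  ... | _ | left b<h  = ℕ.<⇒≢ (ℕ.<-≤-trans b<h (ℕ.m≤m+n h x))
  ... | _ | right h≤b = ℕ.<⇒≢ (ℕ.<-≤-trans (ℕ.+-monoʳ-< h x<k) (ℕ.+-monoˡ-≤ k h≤b)) ∘ sym

  -- Different columns have different positions, and none falls into the block from `h` to
  -- `h + k - 1` kept for the new vertices.
  position-clique : ∀ l l′ → position l ≡ position l′ → l ≡ l′ ⊎ SameColumn l l′
  position-clique (inj₁ _) (inj₁ _)  eq = inj₂ (Fin.toℕ-injective (columnPosition-injective _ _ eq))
  position-clique (inj₁ (_ , b)) (inj₂ x) eq = contradiction eq (columnPosition-misses (toℕ b) (Fin.toℕ<n x))
  position-clique (inj₂ x) (inj₁ (_ , b)) eq = contradiction (sym eq) (columnPosition-misses (toℕ b) (Fin.toℕ<n x))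
  position-clique (inj₂ _) (inj₂ _)  eq = inj₁ (cong inj₂ (Fin.toℕ-injective (ℕ.+-cancelˡ-≡ h _ _ eq)))

  columnPosition-left : ∀ {b} → b < h → columnPosition b ≡ b
  columnPosition-left {b} b<h with columnPosition b | columnView b
  ... | _ | left _    = refl
  ... | _ | right h≤b = contradiction b<h (ℕ.≤⇒≯ h≤b)

  columnPosition-right : ∀ {b} → h ≤ b → columnPosition b ≡ b + k
  columnPosition-right {b} h≤b with columnPosition b | columnView b
  ... | _ | left b<h = contradiction b<h (ℕ.≤⇒≯ h≤b)
  ... | _ | right _  = refl

  position-onto : 1 ≤ n → ∀ {c} → c < n + k → ∃ λ l → position l ≡ c
  position-onto 1≤n {c} c<n+k = go (c ℕ.<? h) (c ℕ.<? h + k)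
    where
    column : ∀ {b} → b < n → ∃ λ l → position l ≡ columnPosition b
    -- Any row would do; row 0 exists because `1 ≤ n`.
    column b<n = inj₁ (fromℕ< 1≤n , fromℕ< b<n) , cong columnPosition (Fin.toℕ-fromℕ< b<n)

    go : Dec (c < h) → Dec (c < h + k) → ∃ λ l → position l ≡ c
    go (yes c<h) _ =
      let l , eq = column (ℕ.<-≤-trans c<h (ℕ.⌊n/2⌋≤n n)) in l , trans eq (columnPosition-left c<h)
    go (no c≮h) (yes c<h+k) =
      inj₂ (fromℕ< x<k) , trans (cong (h +_) (Fin.toℕ-fromℕ< x<k)) h+x≡c
      where
      h+x≡c : h + (c ∸ h) ≡ c
      h+x≡c = ℕ.m+[n∸m]≡n (ℕ.≮⇒≥ c≮h)
      x<k : c ∸ h < k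
      x<k = ℕ.+-cancelˡ-< h _ _ (subst (_< h + k) (sym h+x≡c) c<h+k)
    go (no _) (no c≮h+k) =
      let l , eq = column (ℕ.+-cancelʳ-< k _ _ (subst (_< n + k) (sym b+k≡c) c<n+k))
      in l , trans eq (trans (columnPosition-right h≤b) b+k≡c)
      where
      h+k≤c : h + k ≤ c
      h+k≤c = ℕ.≮⇒≥ c≮h+k
      b+k≡c : c ∸ k + k ≡ c
      b+k≡c = ℕ.m∸n+n≡m (ℕ.m+n≤o⇒n≤o h h+k≤c)
      h≤b : h ≤ c ∸ k
      h≤b = ℕ.+-cancelʳ-≤ k _ _ (subst (h + k ≤_) (sym b+k≡c) h+k≤c)

  -- Each column is shifted by either 0 or `k`.
  columnPosition-lipschitz : ∀ b b′ → ∣ columnPosition b - columnPosition b′ ∣ ≤ ∣ b - b′ ∣ + k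
  columnPosition-lipschitz b b′ = ∣-∣-least (grow b b′)
    (subst (λ d → columnPosition b′ ≤ columnPosition b + (d + k)) (ℕ.∣-∣-comm b′ b) (grow b′ b))
    where
    lower : ∀ b → b ≤ columnPosition b
    lower b with columnPosition b | columnView b
    ... | _ | left _  = ℕ.≤-refl
    ... | _ | right _ = ℕ.m≤m+n b k

    upper : ∀ b → columnPosition b ≤ b + k
    upper b with columnPosition b | columnView b
    ... | _ | left _  = ℕ.m≤m+n b k
    ... | _ | right _ = ℕ.≤-refl

    grow : ∀ b b′ → columnPosition b ≤ columnPosition b′ + (∣ b - b′ ∣ + k)
    grow b b′ = begin
      columnPosition b                    ≤⟨ upper b ⟩
      b + k                               ≤⟨ ℕ.+-monoˡ-≤ k (ℕ.m≤n+∣m-n∣ b b′) ⟩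
      b′ + ∣ b - b′ ∣ + k                 ≡⟨ ℕ.+-assoc b′ _ k ⟩
      b′ + (∣ b - b′ ∣ + k)               ≤⟨ ℕ.+-monoˡ-≤ _ (lower b′) ⟩
      columnPosition b′ + (∣ b - b′ ∣ + k) ∎
      where open ℕ.≤-Reasoning

  -- From the middle block, the first position is less than `h + k` away. The last position is
  -- `n + k - 1`, at most `h + h + k` as `n ≤ 2h + 1`, so it is at most `h + k` away even for odd
  -- `n`.
  new-near : ∀ {c} (x : Fin k) → c < n + k → ∣ c - h + toℕ x ∣ ≤ h + k
  new-near {c} x c<n+k = ∣-∣-least (begin
    c                     ≤⟨ s≤s⁻¹ (ℕ.≤-trans c<n+k (ℕ.+-monoˡ-≤ k n≤1+h+h)) ⟩
    h + h + k             ≡⟨ ℕ.+-assoc h h k ⟩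
    h + (h + k)           ≤⟨ ℕ.+-monoˡ-≤ (h + k) (ℕ.m≤m+n h (toℕ x)) ⟩
    h + toℕ x + (h + k)   ∎)
    (ℕ.≤-trans (ℕ.+-monoʳ-≤ h (ℕ.<⇒≤ (Fin.toℕ<n x))) (ℕ.m≤n+m _ c))
    where open ℕ.≤-Reasoning

-- The chordal row graph and the column graph of (ii).

module _ {k n m} {G : Graph m} (g : Ĝ k n G) where
  open Labels k n
  open Ĝ g
  open Inverse vertices renaming (to to label; from to vertex)

  label-injective : ∀ {u v} → label u ≡ label v → u ≡ v
  label-injective eq = trans (sym (strictlyInverseʳ _)) (trans (cong vertex eq) (strictlyInverseʳ _))

  adj-labels : ∀ {u v} → Adj G u v → Adj G (vertex (label u)) (vertex (label v))
  adj-labels = subst₂ (Adj G) (sym (strictlyInverseʳ _)) (sym (strictlyInverseʳ _))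

  rowGraph : Graph m
  rowGraph = record
    { Adj    = λ u v → u ≢ v × CloseRows (label u) (label v)
    ; adj?   = λ u v → ¬? (u Fin.≟ v) ×-dec closeRows? (label u) (label v)
    ; symm   = λ {u} {v} (u≢v , close) → u≢v ∘ sym , closeRows-symm {label u} {label v} close
    ; irrefl = λ u≡v (u≢v , _) → u≢v u≡v
    }

  columnGraph : Graph m
  columnGraph = record
    { Adj    = λ u v → Adj G u v ⊎ u ≢ v × SameColumn (label u) (label v)
    ; adj?   = λ u v → adj? G u v ⊎-dec ¬? (u Fin.≟ v) ×-dec sameColumn? (label u) (label v)
    ; symm   = λ where
        (inj₁ a) → inj₁ (symm G a)
        {u} {v} (inj₂ (u≢v , same)) → inj₂ (u≢v ∘ sym , sameColumn-symm {label u} {label v} same)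
    ; irrefl = λ where
        u≡v (inj₁ a)         → irrefl G u≡v a
        u≡v (inj₂ (u≢v , _)) → u≢v u≡v
    }

  rowGraph-chordal : Chordal rowGraph
  rowGraph-chordal = key⇒chordal rowGraph (rowKey ∘ label) λ {u} {v} {w} uv uw (_ , a) (_ , b) →
    simp v w (rowKey-simplicial (label u) (label v) (label w) uv uw a b)
    where
    simp : ∀ v w → CloseRows (label v) (label w) → Adj⁼ rowGraph v w
    simp v w close with v Fin.≟ w
    ... | yes refl = refl
    ... | no v≢w   = [ v≢w , close ]

  adj⇒closeRows : ∀ l l′ → Adj G (vertex l) (vertex l′) → CloseRows l l′
  adj⇒closeRows (inj₁ p) (inj₁ q) a =
    ℕ.≤-trans (ℕ.m≤m+n _ _) (ℕ.≤-reflexive (Equivalence.to (grid-edges p q) a))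
  adj⇒closeRows (inj₁ _) (inj₂ _) _ = tt
  adj⇒closeRows (inj₂ _) _        _ = tt

  close-in-column⇒adj : ∀ l l′ → l ≢ l′ → CloseRows l l′ → SameColumn l l′ → Adj G (vertex l) (vertex l′)
  close-in-column⇒adj (inj₁ p@(a , b)) (inj₁ q@(a′ , _)) l≢l′ close refl =
    Equivalence.from (grid-edges p q)
      (cong₂ _+_ (ℕ.≤-antisym close (ℕ.n≢0⇒n>0 (l≢l′ ∘ same-row ∘ ℕ.∣m-n∣≡0⇒m≡n)))
                 (ℕ.∣n-n∣≡0 (toℕ b)))
    where
    same-row : toℕ a ≡ toℕ a′ → inj₁ p ≡ inj₁ q
    same-row = cong (λ a → inj₁ (a , b)) ∘ Fin.toℕ-injective

  -- The edges added in `columnGraph` lie within columns, and those of them that are also in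
  -- `rowGraph` join vertically consecutive vertices, so they are grid edges already.
  intersection : G IsIntersectionOf (rowGraph ∷ columnGraph ∷ [])
  intersection u v = mk⇔ to from
    where
    to : Adj G u v → ∀ i → Adj ((rowGraph ∷ columnGraph ∷ []) i) u v
    to a zero       = (λ u≡v → irrefl G u≡v a) , adj⇒closeRows (label u) (label v) (adj-labels a)
    to a (suc zero) = inj₁ a

    from : (∀ i → Adj ((rowGraph ∷ columnGraph ∷ []) i) u v) → Adj G u v
    from a with a zero | a (suc zero)
    ... | _           | inj₁ uv         = uv
    ... | _ , close   | inj₂ (u≢v , same) =
      subst₂ (Adj G) (strictlyInverseʳ u) (strictlyInverseʳ v)
        (close-in-column⇒adj (label u) (label v) (u≢v ∘ label-injective) close same)

  -- Adjacent grid vertices are at most one column apart, so the middle block adds at most `k` to a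
  -- difference that `half-spread` bounds by `h`. All other edges have a new end, and `new-near`
  -- applies.
  position-near : ∀ l l′ → Adj G (vertex l) (vertex l′) → ∣ position l′ - position l ∣ ≤ h + k
  position-near (inj₁ p@(_ , b)) (inj₁ q@(_ , b′)) a =
    ℕ.≤-trans (columnPosition-lipschitz (toℕ b′) (toℕ b)) (ℕ.+-monoˡ-≤ k (half-spread b′ b
      (ℕ.≤-trans (ℕ.m≤n+m _ _) (ℕ.≤-reflexive (Equivalence.to (grid-edges q p) (symm G a))))))
  position-near l (inj₂ x) _ = subst (_≤ h + k) (ℕ.∣-∣-comm (position l) (h + toℕ x)) (new-near x (position< l))
  position-near (inj₂ x) l _ = new-near x (position< l)

  sameColumn⇒position≡ : ∀ l l′ → SameColumn l l′ → position l ≡ position l′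
  sameColumn⇒position≡ (inj₁ _) (inj₁ _) = cong (columnPosition ∘ toℕ)

  class : Fin m → Fin (n + k)
  class u = fromℕ< (position< (label u))

  toℕ-class : ∀ u → toℕ (class u) ≡ position (label u)
  toℕ-class u = Fin.toℕ-fromℕ< (position< (label u))

  class-cover : 1 ≤ n → IsCliqueCover columnGraph class
  class-cover 1≤n = onto , clique
    where
    onto : ∀ c → ∃ λ u → class u ≡ c
    onto c with l , eq ← position-onto 1≤n (Fin.toℕ<n c) = vertex l , Fin.toℕ-injective
      (trans (toℕ-class (vertex l)) (trans (cong position (strictlyInverseˡ l)) eq))

    clique : ∀ u v → u ≢ v → class u ≡ class v → Adj columnGraph u v
    clique u v u≢v eq
      with position-clique (label u) (label v) (trans (sym (toℕ-class u)) (trans (cong toℕ eq) (toℕ-class v)))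
    ... | inj₁ l≡l′ = contradiction (label-injective l≡l′) u≢v
    ... | inj₂ same = inj₂ (u≢v , same)

  class-near : ∀ u v → Adj columnGraph u v → ∣ toℕ (class v) - toℕ (class u) ∣ ≤ h + k
  class-near u v adj rewrite toℕ-class u | toℕ-class v with adj
  ... | inj₁ a          = position-near (label u) (label v) (adj-labels a)
  ... | inj₂ (_ , same) =
    ℕ.≤-trans (ℕ.≤-reflexive (ℕ.m≡n⇒∣m-n∣≡0 (sym (sameColumn⇒position≡ (label u) (label v) same)))) z≤n

  columnGraph-ccw : 1 ≤ n → 2 * ccw columnGraph ≤ n + 2 * k
  columnGraph-ccw 1≤n = begin
    2 * ccw columnGraph ≤⟨ ℕ.*-monoʳ-≤ 2 (ccw-least columnGraph class (class-cover 1≤n) class-near) ⟩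
    2 * (h + k)         ≡⟨ ℕ.*-distribˡ-+ 2 h k ⟩
    2 * h + 2 * k       ≤⟨ ℕ.+-monoˡ-≤ (2 * k) 2h≤n ⟩
    n + 2 * k           ∎
    where
    open ℕ.≤-Reasoning
    2h≤n : 2 * h ≤ n
    2h≤n = begin
      h + (h + 0)     ≡⟨ cong (h +_) (ℕ.+-identityʳ h) ⟩
      h + h           ≤⟨ ℕ.+-monoʳ-≤ h (ℕ.⌊n/2⌋≤⌈n/2⌉ n) ⟩
      h + ⌈ n /2⌉     ≡⟨ ℕ.⌊n/2⌋+⌈n/2⌉≡n n ⟩
      n               ∎

theorem2p1 : (∃ λ (p : ℕ) → ∃ λ (q : ℕ) → ∃ λ (n₀ : ℕ) → 0 < p × 0 < q ×
    (∀ n k r → n₀ ≤ n → 1 ≤ n → 1 ≤ k → 1 ≤ r →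
    ∀ {m} (G : Graph m) → Ĝ k n G →
    (Gs : Fin (suc r) → Graph m) → Chordal (Gs zero) → G IsIntersectionOf Gs →
    max (λ i → ccw (Gs (suc i))) ≥[ p / q ]·root[ r ] n))
    ×
    (∀ n k → 1 ≤ n → 1 ≤ k →
    ∀ {m} (G : Graph m) → Ĝ k n G →
    Σ (Graph m) λ G₁ → Σ (Graph m) λ G₂ →
    Chordal G₁ × 2 * ccw G₂ ≤ n + 2 * k × G IsIntersectionOf (G₁ ∷ G₂ ∷ []))
theorem2p1 =
  -- The constants are `c = 1/6` and `n₀ = 3`, as found in `half-bound⇒root-bound`.
  (1 , 6 , 3 , s≤s z≤n , s≤s z≤n , λ n k r 3≤n _ → lower-bound n k r 3≤n) ,
  λ n k 1≤n _ G g →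
    rowGraph g , columnGraph g , rowGraph-chordal g , columnGraph-ccw g 1≤n , intersection g
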